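{- Let $m\in\mathbb N$ and let $C$ be an $m\times\omega$ matrix with rational entries and only finitely many nonzero entries in each row, such that $A=\left(\begin{array}{c}C\\ {\bf D}\end{array}\right)$ is image partition regular, where ${\bf D}$ is the DH-matrix. Then ${\bf D}$ image dominates $A$.
   Context: $\mathbb N=\{1,2,3,\ldots\}$, $\omega=\{0,1,2,\ldots\}$. All matrices have rational entries and only finitely many nonzero entries in each row. A matrix is image partition regular (IPR) if, whenever $\mathbb N$ is finitely coloured, there is a vector $\vec x$ with entries in $\mathbb N$ such that all entries of the image are natural numbers of the same colour. For a vector $\vec x$, $Im(\vec x)$ is the set of its entries. Image domination: for $t,u,v,w\in\mathbb N\cup\{\omega\}$ (or, after relabelling, any countable index sets), a $t\times u$ matrix $A$ image dominates a $v\times w$ matrix $B$ if and only if for each $\vec x\in\mathbb N^u$ there exists $\vec y\in\mathbb N^w$ such that $Im(B\vec y)\subseteq Im(A\vec x)$. The DH-matrix ${\bf D}$: fix an enumeration $\langle B_n\rangle_{n=0}^\infty$ of the finite IPR matrices with rational entries, where $B_n$ is a $u(n)\times v(n)$ matrix. Let $\vec 0_i$ be the zero vector with $i$ entries. ${\bf D}$ is an $\omega\times\omega$ matrix whose rows are all the concatenations $\vec r_0{}^\frown\vec r_1{}^\frown\vec r_2{}^\frown\cdots$ where each $\vec r_i$ is either $\vec 0_{v(i)}$ or a row of $B_i$, and all but finitely many (but not all) of the $\vec r_i$ are $\vec 0_{v(i)}$. -}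

module Defs where

open import Data.Fin using (Fin; toℕ)
open import Data.Integer using (+_)
open import Data.List using (List; allFin; foldr; map)
open import Data.List.Membership.Propositional using (_∉_)
open import Data.List.Membership.Propositional.Properties using (∈-allFin)
open import Data.List.Relation.Unary.Unique.Propositional using (Unique)
open import Data.List.Relation.Unary.Unique.Propositional.Properties using (allFin⁺)
open import Data.Nat as ℕ using (ℕ; zero; suc; NonZero)
open import Data.Product using (∃; ∃-syntax; _×_)
open import Data.Rational using (ℚ; 0ℚ; _+_; _*_; _/_)
open import Data.Sum using (_⊎_; inj₁; inj₂; [_,_])
open import Data.Vec using (Vec; lookup; replicate)
open import Data.Vec.Membership.Propositional using (_∈_)
open import Relation.Binary.PropositionalEquality using (_≡_)
open import Relation.Nullary using (¬_; contradiction)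
open import Relation.Unary using (Pred; _⊆_)
open import Level using (0ℓ)

record ℕ⁺ : Set where
  constructor mkℕ⁺
  field
    value : ℕ
    .{{nonZero}} : NonZero value

toℚ : ℕ⁺ → ℚ
toℚ n = + ℕ⁺.value n / 1

-- Rational matrices with arbitrary index types and finitely many nonzero
-- entries in each row: `support i` is a repetition-free list containing every
-- column at which row i is nonzero (it may also contain columns where it is 0).
record Matrix (I J : Set) : Set where
  field
    entry    : I → J → ℚ
    support  : I → List J
    unique   : ∀ i → Unique (support i)
    vanishes : ∀ i {j} → j ∉ support i → entry i j ≡ 0ℚ

open Matrix public

-- Since `support i` lists each of its columns once and the row is 0 elsewhere,
-- the value does not depend on which admissible list is chosen.
infixl 7 _·_
_·_ : {I J : Set} → Matrix I J → (J → ℕ⁺) → I → ℚ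
(A · x) i = foldr _+_ 0ℚ (map (λ j → entry A i j * toℚ (x j)) (support A i))

Im : {I : Set} → (I → ℚ) → Pred ℚ 0ℓ
Im z q = ∃[ i ] z i ≡ q

ImagePartitionRegular : {I J : Set} → Matrix I J → Set
ImagePartitionRegular {I} {J} A =
  ∀ {k : ℕ} (χ : ℕ⁺ → Fin k) →
  ∃[ x ] ∃[ c ] ∀ i → ∃[ n ] ((A · x) i ≡ toℚ n × χ n ≡ c)

_ImageDominates_ : {I J K L : Set} → Matrix I J → Matrix K L → Set
_ImageDominates_ {J = J} {L = L} A B =
  ∀ (x : J → ℕ⁺) → ∃ λ (y : L → ℕ⁺) → Im (B · y) ⊆ Im (A · x)

-- The block matrix with A above B.
stack : {I I′ J : Set} → Matrix I J → Matrix I′ J → Matrix (I ⊎ I′) J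
stack A B .entry    = [ entry A , entry B ]
stack A B .support  = [ support A , support B ]
stack A B .unique   = λ { (inj₁ i) → unique A i   ; (inj₂ i) → unique B i }
stack A B .vanishes = λ { (inj₁ i) → vanishes A i ; (inj₂ i) → vanishes B i }

-- Entries are stored in vectors so that propositional equality of finite
-- matrices is entrywise equality.
record FiniteMatrix : Set where
  field
    rows cols : ℕ
    .{{rows-nonZero}} : NonZero rows
    .{{cols-nonZero}} : NonZero cols
    entries : Vec (Vec ℚ cols) rows

open FiniteMatrix public

toMatrix : (M : FiniteMatrix) → Matrix (Fin (rows M)) (Fin (cols M))
toMatrix M .entry i j        = lookup (lookup (entries M) i) j
toMatrix M .support _        = allFin (cols M)
toMatrix M .unique _         = allFin⁺ (cols M)
toMatrix M .vanishes _ {j} j∉ = contradiction (∈-allFin j) j∉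

-- Repetitions are allowed.
EnumeratesFiniteIPR : (ℕ → FiniteMatrix) → Set
EnumeratesFiniteIPR B =
  (∀ n → ImagePartitionRegular (toMatrix (B n))) ×
  (∀ M → ImagePartitionRegular (toMatrix M) → ∃[ n ] B n ≡ M)

module _ (v : ℕ → ℕ) where

  offset : ℕ → ℕ
  offset zero    = 0
  offset (suc n) = offset n ℕ.+ v n

  -- s = r 0 ⌢ r 1 ⌢ r 2 ⌢ ⋯ ; this determines s whenever infinitely many of
  -- the lengths v n are positive.
  IsConcatenation : ((n : ℕ) → Vec ℚ (v n)) → (ℕ → ℚ) → Set
  IsConcatenation r s =
    ∀ n (i : Fin (v n)) → s (offset n ℕ.+ toℕ i) ≡ lookup (r n) i

module _ (B : ℕ → FiniteMatrix) where

  private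
    width : ℕ → ℕ
    width n = cols (B n)

  IsDHSequence : ((n : ℕ) → Vec ℚ (cols (B n))) → Set
  IsDHSequence r =
    (∀ n → r n ≡ replicate (width n) 0ℚ ⊎ r n ∈ entries (B n)) ×
    (∃[ N ] ∀ n → N ℕ.≤ n → r n ≡ replicate (width n) 0ℚ) ×
    ¬ (∀ n → r n ≡ replicate (width n) 0ℚ)

  -- The rows of D, listed in any order and possibly with repetitions, are
  -- exactly the concatenations of the sequences above.
  IsDHMatrix : Matrix ℕ ℕ → Set
  IsDHMatrix D =
    (∀ i → ∃[ r ] (IsDHSequence r × IsConcatenation width r (entry D i))) ×
    (∀ r → IsDHSequence r → ∃[ i ] IsConcatenation width r (entry D i))

{-# OPTIONS --safe #-}

-- D · x consists of the sums Σ_{n ∈ F} bₙ with F finite, nonempty and bₙ an entry of Bₙ xₙ, where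
-- xₙ is the n-th block of x.  Let H be so large that C vanishes outside the first H blocks.  The
-- rows of C cut down to these blocks, together with the nonzero concatenations of selections from
-- B₀, …, B_{H-1}, form a finite matrix E, which is IPR because A is; say E = B_{k₀}.  For n ≥ H,
-- repeating the rows of Bₙ gives IPR matrices with the same images, so there are indices σ n,
-- pairwise distinct and different from k₀, such that B_{σ n} has every row of Bₙ.  Let the first
-- H blocks of y together be block k₀ of x, and let block n ≥ H of y be block σ n of x.  An entry
-- of A · y is then a sum of entries from distinct blocks of D · x.

module Submission where

open import Defs
open import Data.Nat using (ℕ; NonZero)
open import Data.Fin using (Fin)
open import Data.Fin using (zero; suc; toℕ; fromℕ<; reduce≥; combine; quotient)
open import Data.Fin.Properties
  using (toℕ-injective; toℕ-fromℕ<; remQuot-combine)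
open import Data.List using (List; []; _∷_; tabulate; filter; map; foldr;
  cartesianProductWith; concatMap; allFin; length)
  renaming (_++_ to _++ₗ_)
open import Data.List.Extrema.Nat using (max; xs≤max)
import Data.List.Membership.DecPropositional as DecMembership
import Data.List.Membership.Propositional as List
open import Data.List.Membership.Propositional.Properties
  using (∈-filter⁺; ∈-filter⁻; ∈-tabulate⁺; ∈-tabulate⁻; ∈-concatMap⁺; ∈-allFin;
         ∈-cartesianProductWith⁺; ∈-cartesianProductWith⁻; ∈-++⁺ˡ; ∈-++⁺ʳ; ∈-++⁻)
open import Data.List.Membership.Propositional.Properties.WithK using (unique∧set⇒bag)
open import Data.List.Properties using (length-++; length-tabulate)
open import Data.List.Relation.Binary.BagAndSetEquality using (∼bag⇒↭)
open import Data.List.Relation.Binary.Permutation.Propositional using (_↭_; ↭⇒↭ₛ)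
open import Data.List.Relation.Binary.Permutation.Propositional.Properties using (map⁺)
import Data.List.Relation.Binary.Permutation.Setoid.Properties as Permutation
import Data.List.Relation.Unary.All as All
open import Data.List.Relation.Unary.Any as Any using (here; there)
open import Data.List.Relation.Unary.Unique.Propositional using (Unique)
open import Data.List.Relation.Unary.Unique.Propositional.Properties
  using (filter⁺; tabulate⁺)
open import Data.Nat using (zero; suc; _≤_; _<_; s≤s; _⊔_; _≤?_; _<?_)
import Data.Nat as ℕ
import Data.Nat.Properties as ℕ
open import Data.Product using (∃-syntax; Σ-syntax; _×_; _,_; proj₁; proj₂)
open import Data.Rational using (ℚ; 0ℚ; _+_; _*_; Positive)
open import Data.Rational.Properties
  using (_≟_; +-0-isCommutativeMonoid; +-identityˡ; +-identityʳ; +-assoc; +-comm;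
         *-zeroˡ; normalize-pos)
open import Data.Sum using (_⊎_; inj₁; inj₂)
open import Data.Vec as Vec using (Vec; []; _∷_; lookup; replicate; _++_; toList; fromList)
open import Data.Vec.Membership.Propositional using (_∈_)
import Data.Vec.Membership.Propositional.Properties as Vec
import Data.Vec.Properties as Vec
import Data.Vec.Relation.Unary.Any as AnyV
import Data.Vec.Relation.Unary.Any.Properties as AnyV
open import Function using (_∘_; id; mk⇔)
open import Relation.Binary.Definitions as Tri using (DecidableEquality)
open import Relation.Binary.PropositionalEquality
  using (_≡_; _≢_; refl; sym; trans; cong; cong₂; subst; setoid; module ≡-Reasoning)
open import Relation.Nullary using (¬_; yes; no; contradiction; ¬?)
open ≡-Reasoning

private
  variable
    I J : Set
    m n : ℕ

-- Finite sums over supports.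

sumOver : (J → ℚ) → List J → ℚ
sumOver f l = foldr _+_ 0ℚ (map f l)

sumOver-↭ : (f : J → ℚ) {l l′ : List J} → l ↭ l′ → sumOver f l ≡ sumOver f l′
sumOver-↭ f p =
  Permutation.foldr-commMonoid (setoid ℚ) +-0-isCommutativeMonoid (↭⇒↭ₛ (map⁺ f p))

sumOver-filter : (f : J → ℚ) (l : List J) →
                 sumOver f (filter (λ j → ¬? (f j ≟ 0ℚ)) l) ≡ sumOver f l
sumOver-filter f []      = refl
sumOver-filter f (j ∷ l) with f j ≟ 0ℚ
... | no  _    = cong (f j +_) (sumOver-filter f l)
... | yes fj≡0 = begin
  sumOver f (filter _ l) ≡⟨ sumOver-filter f l ⟩
  sumOver f l            ≡⟨ +-identityˡ _ ⟨
  0ℚ + sumOver f l       ≡⟨ cong (_+ sumOver f l) fj≡0 ⟨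
  f j + sumOver f l      ∎

-- Columns with zero term contribute nothing, so both lists may be cut down to the columns where `f`
-- is nonzero. The remaining lists have the same members and no repetitions, hence are permutations
-- of each other.
sumOver-support : DecidableEquality J → (f : J → ℚ) {l l′ : List J} →
                  Unique l → Unique l′ →
                  (∀ {j} → j List.∉ l → f j ≡ 0ℚ) → (∀ {j} → j List.∉ l′ → f j ≡ 0ℚ) →
                  sumOver f l ≡ sumOver f l′
sumOver-support {J} _≟ⱼ_ f {l} {l′} u u′ off off′ = begin
  sumOver f l                    ≡⟨ sumOver-filter f l ⟨
  sumOver f (filter nonzero? l)  ≡⟨ sumOver-↭ f (∼bag⇒↭ (unique∧set⇒bag
                                      (filter⁺ nonzero? u) (filter⁺ nonzero? u′)
                                      (mk⇔ (move l l′ off′) (move l′ l off)))) ⟩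
  sumOver f (filter nonzero? l′) ≡⟨ sumOver-filter f l′ ⟩
  sumOver f l′                   ∎
  where
  open DecMembership _≟ⱼ_ using (_∈?_)
  nonzero? = λ j → ¬? (f j ≟ 0ℚ)
  move : ∀ k k′ → (∀ {j} → j List.∉ k′ → f j ≡ 0ℚ) →
         ∀ {j} → j List.∈ filter nonzero? k → j List.∈ filter nonzero? k′
  move k k′ off″ {j} j∈ with ∈-filter⁻ nonzero? {xs = k} j∈ | j ∈? k′
  ... | _ , fj≢0 | yes j∈k′ = ∈-filter⁺ nonzero? j∈k′ fj≢0
  ... | _ , fj≢0 | no  j∉k′ = contradiction (off″ j∉k′) fj≢0

sumOver-zero : (f : J → ℚ) (l : List J) → (∀ j → f j ≡ 0ℚ) → sumOver f l ≡ 0ℚ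
sumOver-zero f []      f≡0 = refl
sumOver-zero f (j ∷ l) f≡0 = cong₂ _+_ (f≡0 j) (sumOver-zero f l f≡0)

-- Finite rows paired with sequences.

dot : Vec ℚ n → (ℕ → ℚ) → ℚ
dot []      z = 0ℚ
dot (q ∷ w) z = q * z 0 + dot w (z ∘ suc)

dot-cong : (w : Vec ℚ n) {z z′ : ℕ → ℚ} → (∀ {j} → j < n → z j ≡ z′ j) →
           dot w z ≡ dot w z′
dot-cong []      eq = refl
dot-cong (q ∷ w) eq = cong₂ _+_ (cong (q *_) (eq ℕ.z<s)) (dot-cong w (eq ∘ ℕ.s<s))

dot-zero : ∀ n z → dot (replicate n 0ℚ) z ≡ 0ℚ
dot-zero zero    z = refl
dot-zero (suc n) z = cong₂ _+_ (*-zeroˡ (z 0)) (dot-zero n (z ∘ suc))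

+-dot-zero : ∀ q n z → q + dot (replicate n 0ℚ) z ≡ q
+-dot-zero q n z = trans (cong (q +_) (dot-zero n z)) (+-identityʳ q)

-- Because the second argument of `dot` is an infinite sequence, a later block is read off the
-- shifted sequence, with no casts between lengths.
dot-++ : (w : Vec ℚ m) (w′ : Vec ℚ n) (z : ℕ → ℚ) →
         dot (w ++ w′) z ≡ dot w z + dot w′ (z ∘ (m ℕ.+_))
dot-++ []      w′ z = sym (+-identityˡ _)
dot-++ (q ∷ w) w′ z =
  trans (cong (q * z 0 +_) (dot-++ w w′ (z ∘ suc))) (sym (+-assoc (q * z 0) _ _))

sumOver-tabulate : (f : J → ℚ) (g : Fin n → J) (w : Vec ℚ n) (z : ℕ → ℚ) →
                   (∀ i → f (g i) ≡ lookup w i * z (toℕ i)) →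
                   sumOver f (tabulate g) ≡ dot w z
sumOver-tabulate f g []      z eq = refl
sumOver-tabulate f g (q ∷ w) z eq =
  cong₂ _+_ (eq zero) (sumOver-tabulate f (g ∘ suc) w (z ∘ suc) (eq ∘ suc))

-- Opaque because with-abstraction would otherwise normalise the rationals in its goals.
opaque
  values : (ℕ → ℕ⁺) → ℕ → ℚ
  values x = toℚ ∘ x

  values-def : ∀ x j → values x j ≡ toℚ (x j)
  values-def x j = refl

  values-cong : ∀ {x x′ j j′} → x j ≡ x′ j′ → values x j ≡ values x′ j′
  values-cong = cong toℚ

·-dot : (A : Matrix I ℕ) (x : ℕ → ℕ⁺) (i : I) (w : Vec ℚ n) →
        (∀ k → entry A i (toℕ k) ≡ lookup w k) → (∀ {j} → n ≤ j → entry A i j ≡ 0ℚ) →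
        (A · x) i ≡ dot w (values x)
·-dot {n = n} A x i w head≡ tail≡0 = trans
  (sumOver-support ℕ._≟_ f (unique A i) (tabulate⁺ toℕ-injective)
    (λ j∉ → f≡0 (vanishes A i j∉)) (λ j∉ → f≡0 (outside j∉)))
  (sumOver-tabulate f toℕ w (values x) (λ k →
    cong₂ _*_ (head≡ k) (sym (values-def x (toℕ k)))))
  where
  f : ℕ → ℚ
  f j = entry A i j * toℚ (x j)
  f≡0 : ∀ {j} → entry A i j ≡ 0ℚ → f j ≡ 0ℚ
  f≡0 {j} eq = trans (cong (_* toℚ (x j)) eq) (*-zeroˡ (toℚ (x j)))
  outside : ∀ {j} → j List.∉ tabulate {n = n} toℕ → entry A i j ≡ 0ℚ
  outside {j} j∉ with j <? n
  ... | no  j≮n = tail≡0 (ℕ.≮⇒≥ j≮n)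
  ... | yes j<n = contradiction
    (subst (List._∈ _) (toℕ-fromℕ< j<n) (∈-tabulate⁺ (fromℕ< j<n))) j∉

toMatrix-dot : (M : FiniteMatrix) (x : ℕ → ℕ⁺) (i : Fin (rows M)) →
               (toMatrix M · (x ∘ toℕ)) i ≡ dot (lookup (entries M) i) (values x)
toMatrix-dot M x i = sumOver-tabulate _ id (lookup (entries M) i) (values x) λ k →
  cong (lookup (lookup (entries M) i) k *_) (sym (values-def x (toℕ k)))

-- Nonzero rows and repeated rows in finite IPR matrices.

toℚ≢0 : ∀ a → toℚ a ≢ 0ℚ
toℚ≢0 (mkℕ⁺ (suc k)) eq with subst Positive eq (normalize-pos (suc k) 1)
... | ()

∈-lookup⁻ : {A : Set} {a : A} {as : Vec A n} → a ∈ as → ∃[ i ] a ≡ lookup as i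
∈-lookup⁻ a∈ = AnyV.index a∈ , AnyV.lookup-index a∈

IPR⇒row≢0 : (M : FiniteMatrix) → ImagePartitionRegular (toMatrix M) →
            ∀ {w} → w ∈ entries M → w ≢ replicate _ 0ℚ
IPR⇒row≢0 M ipr w∈ w≡0 =
  -- One colour is enough: only the positivity of the image entries matters here.
  let x , _ , mono = ipr {1} (λ _ → zero)
      i , w≡       = ∈-lookup⁻ w∈
      a , eq , _   = mono i
  in toℚ≢0 a (trans (sym eq) (sumOver-zero _ (allFin (cols M)) λ j →
       trans (cong (_* toℚ (x j)) (begin
         lookup (lookup (entries M) i) j ≡⟨ cong (λ u → lookup u j) (trans (sym w≡) w≡0) ⟩
         lookup (replicate _ 0ℚ) j       ≡⟨ Vec.lookup-replicate j 0ℚ ⟩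
         0ℚ                              ∎))
       (*-zeroˡ (toℚ (x j)))))

-- Repeating rows leaves every image unchanged while pushing the row count above `p`. Row counts
-- later serve to tell apart indices of the enumeration.
copies : FiniteMatrix → ℕ → FiniteMatrix
copies M@record { rows = r ; cols = c ; rows-nonZero = nz ; entries = E } p = record
  { rows         = r ℕ.* suc p
  ; cols         = c
  ; rows-nonZero = ℕ.m*n≢0 r (suc p) {{nz}}
  ; entries      = Vec.tabulate (λ i → lookup E (quotient (suc p) i))
  }

copies-rows : ∀ M p → p < rows (copies M p)
copies-rows record { rows = r ; rows-nonZero = nz } p = ℕ.m≤n*m (suc p) r {{nz}}

copies-∈ : ∀ M p {w} → w ∈ entries M → w ∈ entries (copies M p)
copies-∈ M@record { entries = E } p w∈ with i , refl ← ∈-lookup⁻ w∈ =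
  subst (_∈ entries (copies M p))
    (cong (λ k → lookup E (proj₁ k)) (remQuot-combine {k = suc p} i zero))
    (Vec.∈-tabulate⁺ _ (combine i zero))

copies-IPR : ∀ M p → ImagePartitionRegular (toMatrix M) →
             ImagePartitionRegular (toMatrix (copies M p))
copies-IPR M@record { cols = c ; entries = E } p ipr χ with x , col , mono ← ipr χ =
  x , col , λ i → let a , eq , χa = mono (quotient (suc p) i) in
    a , trans (cong (value x) (Vec.lookup∘tabulate _ i)) eq , χa
  where
  value : (Fin c → ℕ⁺) → Vec ℚ c → ℚ
  value x w = sumOver (λ j → lookup w j * toℚ (x j)) (allFin c)

-- Concatenations of blocks.

replicate-++ : ∀ {A : Set} m n {a : A} → replicate m a ++ replicate n a ≡ replicate (m ℕ.+ n) a
replicate-++ zero    n = refl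
replicate-++ (suc m) n = cong (_ ∷_) (replicate-++ m n)

+-reduce≥ : ∀ m (i : Fin (m ℕ.+ n)) (m≤i : m ≤ toℕ i) → m ℕ.+ toℕ (reduce≥ i m≤i) ≡ toℕ i
+-reduce≥ zero    i       m≤i       = refl
+-reduce≥ (suc m) (suc i) (s≤s m≤i) = cong suc (+-reduce≥ m i m≤i)

module Blocks (v : ℕ → ℕ) where

  private
    variable
      k N : ℕ
      r r′ : ∀ n → Vec ℚ (v n)
      s : ℕ → ℚ

  Rows : Set
  Rows = ∀ n → Vec ℚ (v n)

  0ʳ : Rows
  0ʳ n = replicate (v n) 0ℚ

  VanishesFrom : ℕ → Rows → Set
  VanishesFrom N r = ∀ n → N ≤ n → r n ≡ 0ʳ n

  vanishes-everywhere : VanishesFrom N r → (∀ {n} → n < N → r n ≡ 0ʳ n) → ∀ n → r n ≡ 0ʳ n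
  vanishes-everywhere {N} van below n with n <? N
  ... | yes n<N = below n<N
  ... | no  n≮N = van n (ℕ.≮⇒≥ n≮N)

  update : Rows → ∀ k → Vec ℚ (v k) → Rows
  update r k w n with n ℕ.≟ k
  ... | yes refl = w
  ... | no  _    = r n

  update-at : ∀ r k w → update r k w k ≡ w
  update-at r k w with k ℕ.≟ k
  ... | yes refl = refl
  ... | no  k≢k  = contradiction refl k≢k

  update-off : ∀ r k w → n ≢ k → update r k w n ≡ r n
  update-off {n} r k w n≢k with n ℕ.≟ k
  ... | yes n≡k = contradiction n≡k n≢k
  ... | no  _   = refl

  update-vanishes : ∀ k w → VanishesFrom N r → VanishesFrom (N ⊔ suc k) (update r k w)
  update-vanishes {N} k w van n ≤n =
    trans (update-off _ k w (ℕ.>⇒≢ (ℕ.m⊔n≤o⇒n≤o N _ ≤n))) (van n (ℕ.m⊔n≤o⇒m≤o N _ ≤n))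

  join : Rows → ∀ N → Vec ℚ (offset v N)
  join r zero    = []
  join r (suc N) = join r N ++ r N

  join-cong : ∀ N → (∀ {n} → n < N → r n ≡ r′ n) → join r N ≡ join r′ N
  join-cong zero    eq = refl
  join-cong (suc N) eq =
    cong₂ _++_ (join-cong N (eq ∘ ℕ.m<n⇒m<1+n)) (eq (ℕ.n<1+n N))

  join≡0⇒≡0 : ∀ N → join r N ≡ replicate _ 0ℚ → n < N → r n ≡ 0ʳ n
  join≡0⇒≡0 {r} (suc N) eq n<1+N
    with init≡ , last≡ ← Vec.++-injective (join r N) (replicate _ 0ℚ)
                           (trans eq (sym (replicate-++ (offset v N) (v N))))
    with ℕ.m<1+n⇒m<n∨m≡n n<1+N
  ... | inj₁ n<N  = join≡0⇒≡0 N init≡ n<N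
  ... | inj₂ refl = last≡

  ≡0⇒join≡0 : ∀ N → (∀ {n} → n < N → r n ≡ 0ʳ n) → join r N ≡ replicate _ 0ℚ
  ≡0⇒join≡0 zero    ≡0 = refl
  ≡0⇒join≡0 (suc N) ≡0 =
    trans (cong₂ _++_ (≡0⇒join≡0 N (≡0 ∘ ℕ.m<n⇒m<1+n)) (≡0 (ℕ.n<1+n N)))
          (replicate-++ (offset v N) (v N))

  dot-join-suc : ∀ r N z → dot (join r (suc N)) z ≡
                           dot (join r N) z + dot (r N) (z ∘ (offset v N ℕ.+_))
  dot-join-suc r N z = dot-++ (join r N) (r N) z

  dot-join-stable : ∀ z p → VanishesFrom N r → dot (join r (p ℕ.+ N)) z ≡ dot (join r N) z
  dot-join-stable z zero    van = refl
  dot-join-stable {N} {r} z (suc p) van = begin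
    dot (join r (suc p ℕ.+ N)) z
      ≡⟨ dot-join-suc r (p ℕ.+ N) z ⟩
    dot (join r (p ℕ.+ N)) z + dot (r (p ℕ.+ N)) _
      ≡⟨ cong (λ w → dot (join r (p ℕ.+ N)) z + dot w _) (van (p ℕ.+ N) (ℕ.m≤n+m N p)) ⟩
    dot (join r (p ℕ.+ N)) z + dot (0ʳ (p ℕ.+ N)) _
      ≡⟨ +-dot-zero _ (v (p ℕ.+ N)) _ ⟩
    dot (join r (p ℕ.+ N)) z
      ≡⟨ dot-join-stable z p van ⟩
    dot (join r N) z ∎

  dot-join-≤ : ∀ {N′} z → N ≤ N′ → VanishesFrom N r → dot (join r N′) z ≡ dot (join r N) z
  dot-join-≤ {N} {r} z N≤N′ van =
    subst (λ k → dot (join r k) z ≡ _) (ℕ.m∸n+n≡m N≤N′) (dot-join-stable z (_ ℕ.∸ N) van)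

  -- Induction on `N`: if block `k` lies before the last one, the new term is commuted past the last
  -- term; if it is the last one, the new row replaces a block contributing zero.
  dot-join-update : ∀ r k w N z → r k ≡ 0ʳ k → k < N →
                    dot (join (update r k w) N) z ≡
                    dot (join r N) z + dot w (z ∘ (offset v k ℕ.+_))
  dot-join-update r k w (suc N) z rk≡0 k<1+N with ℕ.m<1+n⇒m<n∨m≡n k<1+N
  ... | inj₁ k<N = begin
    dot (join (update r k w) (suc N)) z
      ≡⟨ dot-join-suc (update r k w) N z ⟩
    dot (join (update r k w) N) z + dot (update r k w N) _
      ≡⟨ cong₂ _+_ (dot-join-update r k w N z rk≡0 k<N)
                   (cong (λ u → dot u _) (update-off r k w (ℕ.>⇒≢ k<N))) ⟩
    (dot (join r N) z + dot w _) + dot (r N) _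
      ≡⟨ +-assoc (dot (join r N) z) _ _ ⟩
    dot (join r N) z + (dot w _ + dot (r N) _)
      ≡⟨ cong (dot (join r N) z +_) (+-comm (dot w _) _) ⟩
    dot (join r N) z + (dot (r N) _ + dot w _)
      ≡⟨ +-assoc (dot (join r N) z) _ _ ⟨
    (dot (join r N) z + dot (r N) _) + dot w _
      ≡⟨ cong (_+ dot w _) (dot-join-suc r N z) ⟨
    dot (join r (suc N)) z + dot w _ ∎
  ... | inj₂ refl = begin
    dot (join (update r k w) (suc k)) z
      ≡⟨ dot-join-suc (update r k w) k z ⟩
    dot (join (update r k w) k) z + dot (update r k w k) _
      ≡⟨ cong₂ _+_ (cong (λ u → dot u z) (join-cong k (λ n<k → update-off r k w (ℕ.<⇒≢ n<k))))
                   (cong (λ u → dot u _) (update-at r k w)) ⟩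
    dot (join r k) z + dot w _
      ≡⟨ cong (_+ dot w (z ∘ (offset v k ℕ.+_))) (+-dot-zero (dot (join r k) z) (v k) _) ⟨
    (dot (join r k) z + dot (0ʳ k) _) + dot w _
      ≡⟨ cong (λ u → (dot (join r k) z + dot u _) + dot w _) rk≡0 ⟨
    (dot (join r k) z + dot (r k) _) + dot w _
      ≡⟨ cong (_+ dot w _) (dot-join-suc r k z) ⟨
    dot (join r (suc k)) z + dot w _ ∎

  lookup-join : IsConcatenation v r s → ∀ N i → lookup (join r N) i ≡ s (toℕ i)
  lookup-join {r} {s} conc (suc N) i with toℕ i <? offset v N
  ... | yes i<o = begin
    lookup (join r N ++ r N) i        ≡⟨ Vec.lookup-++-< (join r N) (r N) i i<o ⟩
    lookup (join r N) (fromℕ< i<o)    ≡⟨ lookup-join {s = s} conc N (fromℕ< i<o) ⟩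
    s (toℕ (fromℕ< i<o))              ≡⟨ cong s (toℕ-fromℕ< i<o) ⟩
    s (toℕ i)                         ∎
  ... | no  i≮o = begin
    lookup (join r N ++ r N) i            ≡⟨ Vec.lookup-++-≥ (join r N) (r N) i o≤i ⟩
    lookup (r N) (reduce≥ i o≤i)          ≡⟨ conc N (reduce≥ i o≤i) ⟨
    s (offset v N ℕ.+ toℕ (reduce≥ i o≤i)) ≡⟨ cong s (+-reduce≥ (offset v N) i o≤i) ⟩
    s (toℕ i)                             ∎
    where o≤i = ℕ.≮⇒≥ i≮o

  -- Positions within blocks.

  offset-mono : m ≤ n → offset v m ≤ offset v n
  offset-mono {n = zero}  ℕ.z≤n = ℕ.≤-refl
  offset-mono {n = suc n} m≤1+n with ℕ.m≤n⇒m<n∨m≡n m≤1+n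
  ... | inj₁ (s≤s m≤n) = ℕ.≤-trans (offset-mono m≤n) (ℕ.m≤m+n _ (v n))
  ... | inj₂ refl      = ℕ.≤-refl

  offset+<offset : ∀ {a} → m < n → a < v m → offset v m ℕ.+ a < offset v n
  offset+<offset {m} m<n a<v =
    ℕ.<-≤-trans (ℕ.+-monoʳ-< (offset v m) a<v) (offset-mono {m = suc m} m<n)

  offset-index-unique : ∀ {a b} → a < v m → b < v n →
                        offset v m ℕ.+ a ≡ offset v n ℕ.+ b → m ≡ n
  offset-index-unique {m} {n} {a} {b} a<v b<v eq with ℕ.<-cmp m n
  ... | Tri.tri≈ _ m≡n _ = m≡n
  ... | Tri.tri< m<n _ _ = contradiction
    (ℕ.<-≤-trans (offset+<offset m<n a<v) (ℕ.m≤m+n _ b)) (ℕ.<-irrefl eq)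
  ... | Tri.tri> _ _ n<m = contradiction
    (ℕ.<-≤-trans (offset+<offset n<m b<v) (ℕ.m≤m+n _ a)) (ℕ.<-irrefl (sym eq))

  module PositiveLengths (v>0 : ∀ n → 0 < v n) where

    -- This turns a bound on columns into a bound on blocks.
    n≤offset : ∀ n → n ≤ offset v n
    n≤offset zero    = ℕ.z≤n
    n≤offset (suc n) = subst (_≤ offset v (suc n)) (ℕ.+-comm n 1) (ℕ.+-mono-≤ (n≤offset n) (v>0 n))

    -- Induction on `j`: advance inside the current block or, at its end, pass to place 0 of the
    -- next block, which exists because all lengths are positive.
    locate : ∀ j → ∃[ n ] ∃[ a ] (a < v n × j ≡ offset v n ℕ.+ a)
    locate zero    = 0 , 0 , v>0 0 , refl
    locate (suc j) with n , a , a<v , refl ← locate j with ℕ.m≤n⇒m<n∨m≡n a<v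
    ... | inj₁ 1+a<v = n , suc a , 1+a<v , sym (ℕ.+-suc _ a)
    ... | inj₂ 1+a≡v = suc n , 0 , v>0 (suc n) ,
      (begin
        suc (offset v n ℕ.+ a) ≡⟨ ℕ.+-suc _ a ⟨
        offset v n ℕ.+ suc a   ≡⟨ cong (offset v n ℕ.+_) 1+a≡v ⟩
        offset v (suc n)       ≡⟨ ℕ.+-identityʳ _ ⟨
        offset v (suc n) ℕ.+ 0 ∎)

    -- Here `σ` gives starting positions rather than block indices, because several blocks will be
    -- sent into one block.
    rearrange : {A : Set} → (ℕ → ℕ) → (ℕ → A) → ℕ → A
    rearrange σ x j = let n , a , _ = locate j in x (σ n ℕ.+ a)

    -- `locate` returns some decomposition of the position; uniqueness of decompositions identifies
    -- it with block `n` and place `a`.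
    rearrange-block : ∀ {A : Set} σ (x : ℕ → A) {a} → a < v n →
                      rearrange σ x (offset v n ℕ.+ a) ≡ x (σ n ℕ.+ a)
    rearrange-block {n} σ x {a} a<v
      with n′ , a′ , a′<v , eq ← locate (offset v n ℕ.+ a)
      with refl ← offset-index-unique a<v a′<v eq
      with refl ← ℕ.+-cancelˡ-≡ (offset v n) a a′ eq = refl

    IsConcatenation-vanishes : IsConcatenation v r s → VanishesFrom N r →
                               ∀ {j} → offset v N ≤ j → s j ≡ 0ℚ
    IsConcatenation-vanishes {r} {s} {N} conc van {j} o≤j
      with n , a , a<v , refl ← locate j with N ≤? n
    ... | no  N≰n = contradiction (offset+<offset (ℕ.≰⇒> N≰n) a<v) (ℕ.≤⇒≯ o≤j)
    ... | yes N≤n = begin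
      s (offset v n ℕ.+ a)                  ≡⟨ cong (λ i → s (_ ℕ.+ i)) (toℕ-fromℕ< a<v) ⟨
      s (offset v n ℕ.+ toℕ (fromℕ< a<v))   ≡⟨ conc n (fromℕ< a<v) ⟩
      lookup (r n) (fromℕ< a<v)             ≡⟨ cong (λ w → lookup w (fromℕ< a<v)) (van n N≤n) ⟩
      lookup (0ʳ n) (fromℕ< a<v)            ≡⟨ Vec.lookup-replicate (fromℕ< a<v) 0ℚ ⟩
      0ℚ                                    ∎

    ·-join : (A : Matrix I ℕ) (x : ℕ → ℕ⁺) (i : I) →
             IsConcatenation v r (entry A i) → VanishesFrom N r →
             (A · x) i ≡ dot (join r N) (values x)
    ·-join {r = r} {N} A x i conc van =
      ·-dot A x i (join r N) (sym ∘ lookup-join {s = entry A i} conc N)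
        (IsConcatenation-vanishes {s = entry A i} conc van)

-- Selections and combinations for the DH-matrix.

cols>0 : ∀ M → 0 < cols M
cols>0 record { cols = c ; cols-nonZero = nz } = ℕ.>-nonZero⁻¹ c {{nz}}

steps⇒<-mono : (f : ℕ → ℕ) → (∀ n → f n < f (suc n)) → m < n → f m < f n
steps⇒<-mono {m} {suc n} f step m<1+n with ℕ.m<1+n⇒m<n∨m≡n m<1+n
... | inj₁ m<n  = ℕ.<-trans (steps⇒<-mono f step m<n) (step n)
... | inj₂ refl = step m

-- The width of a matrix found in the enumeration is known only up to a propositional equality, so
-- rows are compared through their pairings with all sequences, which avoids transport.
HasRow : FiniteMatrix → Vec ℚ n → Set
HasRow M w = ∃[ w′ ] (w′ ∈ entries M × (∀ z → dot w′ z ≡ dot w z))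

∈⇒HasRow : ∀ {M M′} → M ≡ M′ → {w : Vec ℚ (cols M′)} → w ∈ entries M′ → HasRow M w
∈⇒HasRow refl w∈ = _ , w∈ , λ _ → refl

module DH (B : ℕ → FiniteMatrix) (enum : EnumeratesFiniteIPR B) where

  open Blocks (λ n → cols (B n)) public
  open PositiveLengths (λ n → cols>0 (B n)) public

  off : ℕ → ℕ
  off = offset (λ n → cols (B n))

  Selection : Rows → Set
  Selection r = ∀ n → r n ≡ 0ʳ n ⊎ r n ∈ entries (B n)

  update-selection : ∀ {r} k w → w ∈ entries (B k) → Selection r → Selection (update r k w)
  update-selection k w w∈ sel n with n ℕ.≟ k
  ... | yes refl = inj₂ w∈
  ... | no  _    = sel n

  joins : ∀ N → List (Vec ℚ (off N))
  joins zero    = [] ∷ []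
  joins (suc N) = cartesianProductWith _++_ (joins N) (0ʳ N ∷ toList (entries (B N)))

  ∈-joins⁺ : ∀ {r} → Selection r → ∀ N → join r N List.∈ joins N
  ∈-joins⁺ sel zero    = here refl
  ∈-joins⁺ {r} sel (suc N) = ∈-cartesianProductWith⁺ _++_ (∈-joins⁺ sel N) last∈
    where
    last∈ : r N List.∈ (0ʳ N ∷ toList (entries (B N)))
    last∈ with sel N
    ... | inj₁ ≡0 = here ≡0
    ... | inj₂ ∈B = there (Vec.∈-toList⁺ ∈B)

  -- Padding a listed word with zero blocks gives an infinite selection, the form in which the rows
  -- of the DH-matrix are described.
  ∈-joins⁻ : ∀ N {w} → w List.∈ joins N →
             ∃[ r ] (Selection r × VanishesFrom N r × join r N ≡ w)
  ∈-joins⁻ zero    (here refl) = 0ʳ , (λ _ → inj₁ refl) , (λ _ _ → refl) , refl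
  ∈-joins⁻ (suc N) w∈
    with _ , u , p∈ , u∈ , refl
      ← ∈-cartesianProductWith⁻ _++_ (joins N) (0ʳ N ∷ toList (entries (B N))) w∈
    with r , sel , van , refl ← ∈-joins⁻ N p∈ =
      update r N u
    , select u∈
    , (λ n N<n → trans (update-off r N u (ℕ.>⇒≢ N<n)) (van n (ℕ.<⇒≤ N<n)))
    , cong₂ _++_ (join-cong N (λ n<N → update-off r N u (ℕ.<⇒≢ n<N))) (update-at r N u)
    where
    select : u List.∈ (0ʳ N ∷ toList (entries (B N))) → Selection (update r N u)
    select (there u∈B) = update-selection N u (Vec.∈-toList⁻ u∈B) sel
    select (here refl) n with n ℕ.≟ N
    ... | yes refl = inj₁ refl
    ... | no  _    = sel n

  record Combination (z : ℕ → ℚ) (q : ℚ) : Set where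
    field
      chosen    : Rows
      bound     : ℕ
      selection : Selection chosen
      vanishing : VanishesFrom bound chosen
      value     : dot (join chosen bound) z ≡ q

  open Combination public

  empty : ∀ z → Combination z 0ℚ
  empty z = record
    { chosen = 0ʳ ; bound = 0 ; selection = λ _ → inj₁ refl
    ; vanishing = λ _ _ → refl ; value = refl }

  -- A selection holds at most one row per block, so only a free block may be filled; its zero
  -- contribution is then what the new term replaces.
  extend : ∀ {z q} (c : Combination z q) k {w} → w ∈ entries (B k) → chosen c k ≡ 0ʳ k →
           Combination z (q + dot w (z ∘ (off k ℕ.+_)))
  extend {z} {q} c k {w} w∈ ≡0 = record
    { chosen    = update (chosen c) k w
    ; bound     = N
    ; selection = update-selection k w w∈ (selection c)
    ; vanishing = update-vanishes k w (vanishing c)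
    ; value     = begin
        dot (join (update (chosen c) k w) N) z
          ≡⟨ dot-join-update (chosen c) k w N z ≡0 (ℕ.m≤n⊔m (bound c) (suc k)) ⟩
        dot (join (chosen c) N) z + dot w _
          ≡⟨ cong (_+ dot w (z ∘ (off k ℕ.+_)))
               (trans (dot-join-≤ z (ℕ.m≤m⊔n (bound c) (suc k)) (vanishing c)) (value c)) ⟩
        q + dot w (z ∘ (off k ℕ.+_)) ∎
    }
    where N = bound c ⊔ suc k

  revalue : ∀ {z q q′} → q ≡ q′ → Combination z q → Combination z q′
  revalue eq c = record
    { chosen = chosen c ; bound = bound c ; selection = selection c
    ; vanishing = vanishing c ; value = trans (value c) eq }

  B-row≢0 : ∀ {n w} → w ∈ entries (B n) → w ≢ 0ʳ n
  B-row≢0 {n} = IPR⇒row≢0 (B n) (proj₁ enum n)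

  -- Block `k` now holds a row of an IPR matrix, and such a row is never zero.
  extend-nontrivial : ∀ {z q} (c : Combination z q) k {w} (w∈ : w ∈ entries (B k))
                      (≡0 : chosen c k ≡ 0ʳ k) → ¬ (∀ n → chosen (extend c k w∈ ≡0) n ≡ 0ʳ n)
  extend-nontrivial c k {w} w∈ ≡0 all≡0 =
    B-row≢0 w∈ (trans (sym (update-at (chosen c) k w)) (all≡0 k))

  -- Copying the rows of B n changes no image, so B n recurs at infinitely many indices; ever
  -- larger row counts keep the chosen indices apart.
  fresh-copies : ∀ k₀ → ∃[ σ ] ((∀ n → σ n ≢ k₀) × (∀ {m n} → m < n → σ n ≢ σ m) ×
                                (∀ n {w} → w ∈ entries (B n) → HasRow (B (σ n)) w))
  fresh-copies k₀ = σ , avoids , injective , has-row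
    where
    index : ∀ n p → ∃[ k ] B k ≡ copies (B n) p
    index n p = proj₂ enum (copies (B n) p) (copies-IPR (B n) p (proj₁ enum n))
    height σ : ℕ → ℕ
    -- Starting with the row count of `B k₀` and shifting the choices by one lets a single strictly
    -- increasing sequence separate the `σ n` both from `k₀` and from each other.
    height zero    = rows (B k₀)
    height (suc n) = rows (B (σ n))
    σ n = proj₁ (index n (height n))
    height-step : ∀ n → height n < height (suc n)
    height-step n = subst (λ M → height n < rows M) (sym (proj₂ (index n (height n))))
                      (copies-rows (B n) (height n))
    avoids : ∀ n → σ n ≢ k₀
    avoids n eq = ℕ.<⇒≢ (steps⇒<-mono height height-step (ℕ.z<s {n})) (cong (rows ∘ B) (sym eq))
    injective : ∀ {m n} → m < n → σ n ≢ σ m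
    injective m<n eq =
      ℕ.<⇒≢ (steps⇒<-mono height height-step (ℕ.s<s m<n)) (cong (rows ∘ B) (sym eq))
    has-row : ∀ n {w} → w ∈ entries (B n) → HasRow (B (σ n)) w
    has-row n w∈ = ∈⇒HasRow (proj₂ (index n (height n))) (copies-∈ (B n) (height n) w∈)

  -- Carrying values at y over to combinations at x.

  module Transfer
    (H k₀ : ℕ) (join-row : ∀ {w} → w List.∈ joins H → w ≢ replicate (off H) 0ℚ → HasRow (B k₀) w)
    (σ : ℕ → ℕ) (σ≢k₀ : ∀ n → σ n ≢ k₀) (σ-injective : ∀ {m n} → m < n → σ n ≢ σ m)
    (σ-row : ∀ n {w} → w ∈ entries (B n) → HasRow (B (σ n)) w) (x : ℕ → ℕ⁺) where

    -- The position in `x` where the copy of block `n` of `y` begins.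
    source : ℕ → ℕ
    source n with n <? H
    ... | yes _ = off k₀ ℕ.+ off n
    ... | no  _ = off (σ n)

    source-< : n < H → source n ≡ off k₀ ℕ.+ off n
    source-< {n} n<H with n <? H
    ... | yes _   = refl
    ... | no  n≮H = contradiction n<H n≮H

    source-≥ : H ≤ n → source n ≡ off (σ n)
    source-≥ {n} H≤n with n <? H
    ... | yes n<H = contradiction n<H (ℕ.≤⇒≯ H≤n)
    ... | no  _   = refl

    y : ℕ → ℕ⁺
    y = rearrange source x

    -- The first `H` blocks of `y` are laid out consecutively from the start of block `k₀` of `x`. A
    -- row spanning them all therefore moves as a whole, which is vital for rows of `C`, whose parts
    -- need not come from the `B n`.
    dot-y-head : (w : Vec ℚ (off H)) →
                 dot w (values y) ≡ dot w (values x ∘ (off k₀ ℕ.+_))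
    dot-y-head w = dot-cong w (values-cong {y} {x} ∘ y-head)
      where
      y-block : ∀ {n a} → a < cols (B n) → off n ℕ.+ a < off H →
                y (off n ℕ.+ a) ≡ x (off k₀ ℕ.+ (off n ℕ.+ a))
      y-block {n} {a} a<v <H = begin
        y (off n ℕ.+ a)              ≡⟨ rearrange-block source x a<v ⟩
        x (source n ℕ.+ a)           ≡⟨ cong (λ k → x (k ℕ.+ a)) (source-< n<H) ⟩
        x (off k₀ ℕ.+ off n ℕ.+ a)   ≡⟨ cong x (ℕ.+-assoc (off k₀) (off n) a) ⟩
        x (off k₀ ℕ.+ (off n ℕ.+ a)) ∎
        where
        n<H : n < H
        n<H = ℕ.≰⇒> λ H≤n → ℕ.<⇒≱ <H (ℕ.≤-trans (offset-mono H≤n) (ℕ.m≤m+n (off n) a))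
      y-head : ∀ {j} → j < off H → y j ≡ x (off k₀ ℕ.+ j)
      y-head {j} j<H = let n , a , a<v , eq = locate j in
        subst (λ k → y k ≡ x (off k₀ ℕ.+ k)) (sym eq) (y-block a<v (subst (_< off H) eq j<H))

    dot-y-block : H ≤ n → (w : Vec ℚ (cols (B n))) →
                  dot w (values y ∘ (off n ℕ.+_)) ≡ dot w (values x ∘ (off (σ n) ℕ.+_))
    dot-y-block H≤n w = dot-cong w λ {j} j<v → values-cong {y} {x}
      (trans (rearrange-block source x j<v) (cong (λ k → x (k ℕ.+ j)) (source-≥ H≤n)))

    -- A single row from block `k₀` does it, leaving all blocks `σ n` free. This serves both the
    -- rows of `C` and the nonzero heads of rows of `D`.
    head-row-combination : ∀ {w : Vec ℚ (off H)} → HasRow (B k₀) w →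
      Σ[ c ∈ Combination (values x) (dot w (values y)) ]
        (∀ n → chosen c (σ n) ≡ 0ʳ (σ n)) × ¬ (∀ n → chosen c n ≡ 0ʳ n)
    head-row-combination {w} (w′ , w′∈ , eq) =
        revalue (trans (+-identityˡ _) (trans (eq _) (sym (dot-y-head w))))
          (extend (empty (values x)) k₀ w′∈ refl)
      , (λ n → update-off 0ʳ k₀ w′ (σ≢k₀ n))
      , extend-nontrivial (empty (values x)) k₀ w′∈ refl

    -- The last component is needed because a nontrivial combination may well have value 0, so
    -- nontriviality cannot be recovered from the value.
    transfer : ∀ {r} → Selection r → ∀ p →
      Σ[ c ∈ Combination (values x) (dot (join r (p ℕ.+ H)) (values y)) ]
        (∀ n → p ℕ.+ H ≤ n → chosen c (σ n) ≡ 0ʳ (σ n)) ×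
        ((∀ n → chosen c n ≡ 0ʳ n) → ∀ {n} → n < p ℕ.+ H → r n ≡ 0ʳ n)
    transfer {r} sel zero with Vec.≡-dec _≟_ (join r H) (replicate (off H) 0ℚ)
    -- `join-row` covers nonzero words only, so a zero head is carried by the empty combination.
    ... | yes ≡0 =
        revalue (sym (trans (cong (λ w → dot w (values y)) ≡0) (dot-zero (off H) _)))
          (empty (values x))
      , (λ _ _ → refl)
      , (λ _ → join≡0⇒≡0 H ≡0)
    ... | no  ≢0
      with c , c≡0 , c≢0 ← head-row-combination {join r H}
             (join-row (∈-joins⁺ sel H) ≢0)
      = c , (λ n _ → c≡0 n) , (λ all≡0 → contradiction all≡0 c≢0)
    transfer {r} sel (suc p) with c , c≡0 , c⇒r ← transfer sel p | sel (p ℕ.+ H)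
    ... | inj₁ rN≡0 =
        revalue (sym (begin
          dot (join r (suc p ℕ.+ H)) (values y)
            ≡⟨ dot-join-suc r N (values y) ⟩
          dot (join r N) (values y) + dot (r N) (values y ∘ (off N ℕ.+_))
            ≡⟨ cong (λ w → dot (join r N) (values y) + dot w (values y ∘ (off N ℕ.+_))) rN≡0 ⟩
          dot (join r N) (values y) + dot (0ʳ N) (values y ∘ (off N ℕ.+_))
            ≡⟨ +-dot-zero _ (cols (B N)) _ ⟩
          dot (join r N) (values y) ∎)) c
      , (λ n N<n → c≡0 n (ℕ.<⇒≤ N<n))
      , (λ all≡0 {n} n<1+N → bounded all≡0 (ℕ.m<1+n⇒m<n∨m≡n n<1+N))
      where
      N = p ℕ.+ H
      bounded : (∀ n → chosen c n ≡ 0ʳ n) → ∀ {n} → n < N ⊎ n ≡ N → r n ≡ 0ʳ n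
      bounded all≡0 (inj₁ n<N)  = c⇒r all≡0 n<N
      bounded all≡0 (inj₂ refl) = rN≡0
    -- Block `σ N` is still free: this is the invariant `c≡0`, maintained because `σ` avoids `k₀`
    -- and does not repeat.
    ... | inj₂ rN∈B with w′ , w′∈ , eq ← σ-row (p ℕ.+ H) rN∈B =
        revalue (begin
          dot (join r N) (values y) + dot w′ (values x ∘ (off (σ N) ℕ.+_))
            ≡⟨ cong (dot (join r N) (values y) +_)
                 (trans (eq _) (sym (dot-y-block (ℕ.m≤n+m H p) (r N)))) ⟩
          dot (join r N) (values y) + dot (r N) (values y ∘ (off N ℕ.+_))
            ≡⟨ dot-join-suc r N (values y) ⟨
          dot (join r (suc p ℕ.+ H)) (values y) ∎)
          (extend c (σ N) w′∈ (c≡0 N ℕ.≤-refl))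
      , (λ n N<n → trans (update-off (chosen c) (σ N) w′ (σ-injective N<n)) (c≡0 n (ℕ.<⇒≤ N<n)))
      , (λ all≡0 → contradiction all≡0 (extend-nontrivial c (σ N) w′∈ (c≡0 N ℕ.≤-refl)))
      where N = p ℕ.+ H

  -- The finite matrix of heads and the domination argument.

  module Domination
    (D : Matrix ℕ ℕ) (isDH : IsDHMatrix B D) {m : ℕ} .{{_ : NonZero m}} (C : Matrix (Fin m) ℕ)
    (ipr : ImagePartitionRegular (stack C D)) (H : ℕ) (H>0 : 0 < H)
    (C-vanishes : ∀ i {j} → off H ≤ j → entry C i j ≡ 0ℚ) where

    -- The second half of `IsDHMatrix` makes a row of `D` from any nontrivial selection; beyond
    -- `bound` that row vanishes.
    D-attains : ∀ {x q} (c : Combination (values x) q) → ¬ (∀ n → chosen c n ≡ 0ʳ n) →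
                ∃[ i ] (D · x) i ≡ q
    D-attains {x} c ≢0 =
      let i , conc = proj₂ isDH (chosen c) (selection c , (bound c , vanishing c) , ≢0)
      in i , trans (·-join D x i conc (vanishing c)) (value c)

    headRow : Fin m → Vec ℚ (off H)
    headRow i = Vec.tabulate (entry C i ∘ toℕ)

    C-head : ∀ x i → (C · x) i ≡ dot (headRow i) (values x)
    C-head x i = ·-dot C x i (headRow i) (λ k → sym (Vec.lookup∘tabulate _ k)) (C-vanishes i)

    nonzero? = λ w → ¬? (Vec.≡-dec _≟_ w (replicate (off H) 0ℚ))

    -- The zero word has to be dropped, since an IPR matrix has no zero row.
    headRows : List (Vec ℚ (off H))
    headRows = tabulate headRow ++ₗ filter nonzero? (joins H)

    -- The rows of `C` alone ensure this, as `m` is positive.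
    headRows>0 : 0 < length headRows
    headRows>0 = subst (0 <_)
      (sym (trans (length-++ (tabulate headRow)) (cong (ℕ._+ k) (length-tabulate headRow))))
      (ℕ.<-≤-trans (ℕ.>-nonZero⁻¹ m) (ℕ.m≤m+n m k))
      where k = length (filter nonzero? (joins H))

    head : FiniteMatrix
    head = record
      { rows         = length headRows
      ; cols         = off H
      ; rows-nonZero = ℕ.>-nonZero headRows>0
      ; cols-nonZero = ℕ.>-nonZero (ℕ.<-≤-trans H>0 (n≤offset H))
      ; entries      = fromList headRows
      }

    -- Each head row is some row of `C` or `D` cut off where only zeros follow, so the value does
    -- not change. A monochromatic vector for the stacked matrix thus restricts to one for `head`.
    head-row-attained : ∀ {w} → w List.∈ headRows → ∀ x →
                        ∃[ i ] (stack C D · x) i ≡ dot w (values x)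
    head-row-attained {w} w∈ x with ∈-++⁻ (tabulate headRow) w∈
    ... | inj₁ w∈C =
      let i , w≡ = ∈-tabulate⁻ w∈C
      in inj₁ i , trans (C-head x i) (cong (λ u → dot u (values x)) (sym w≡))
    ... | inj₂ w∈D =
      let w∈joins , w≢0         = ∈-filter⁻ nonzero? {xs = joins H} w∈D
          r , sel , van , join≡ = ∈-joins⁻ H w∈joins
          i , eq = D-attains {x}
            (record { chosen = r ; bound = H ; selection = sel ; vanishing = van
                    ; value = cong (λ u → dot u (values x)) join≡ })
            (λ r≡0 → w≢0 (trans (sym join≡) (≡0⇒join≡0 H (λ _ → r≡0 _))))
      in inj₂ i , eq

    head-IPR : ImagePartitionRegular (toMatrix head)
    head-IPR χ =
      let x , c , mono = ipr χ in
      x ∘ toℕ , c , λ i →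
        let w∈           = Vec.∈-fromList⁻ (Vec.∈-lookup i (fromList headRows))
            i′ , eq      = head-row-attained w∈ x
            a , eq′ , χa = mono i′
        in a , trans (toMatrix-dot head x i) (trans (sym eq) eq′) , χa

    k₀ : ℕ
    k₀ = proj₁ (proj₂ enum head head-IPR)

    head-row : ∀ {w} → w List.∈ headRows → HasRow (B k₀) w
    head-row w∈ = ∈⇒HasRow (proj₂ (proj₂ enum head head-IPR)) (Vec.∈-fromList⁺ w∈)

    fresh = fresh-copies k₀

    module _ (x : ℕ → ℕ⁺) where

      open Transfer H k₀
        (λ w∈ w≢0 → head-row (∈-++⁺ʳ (tabulate headRow) (∈-filter⁺ nonzero? w∈ w≢0)))
        (proj₁ fresh) (proj₁ (proj₂ fresh)) (proj₁ (proj₂ (proj₂ fresh)))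
        (proj₂ (proj₂ (proj₂ fresh))) x public

      attained : ∀ i → ∃[ i′ ] (D · x) i′ ≡ (stack C D · y) i
      attained (inj₁ i) =
        let w∈          = ∈-++⁺ˡ (∈-tabulate⁺ {f = headRow} i)
            c , _ , c≢0 = head-row-combination {headRow i} (head-row w∈)
            i′ , eq     = D-attains c c≢0
        in i′ , trans eq (sym (C-head y i))
      attained (inj₂ i) =
        let r , (sel , (N , van) , r≢0) , conc = proj₁ isDH i
            van′ : VanishesFrom (N ℕ.+ H) r
            -- The bound `N` is raised to `N + H`, the form that `transfer` handles.
            van′ n N+H≤n = van n (ℕ.m+n≤o⇒m≤o N N+H≤n)
            c , _ , c⇒r = transfer sel N
            i′ , eq     = D-attains c (λ all≡0 → r≢0 (vanishes-everywhere van′ (c⇒r all≡0)))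
        in i′ , trans eq (sym (·-join D y i conc van′))

-- Bounding the columns of C, and conclusion.

column-bound : (C : Matrix (Fin m) ℕ) → ∃[ N ] ∀ i {j} → N ≤ j → entry C i j ≡ 0ℚ
-- `suc` puts the bound strictly above every supporting column; the default 0 covers empty supports.
column-bound {m} C = suc (max 0 columns) , λ i N≤j → vanishes C i λ j∈ →
  ℕ.<⇒≱ N≤j (All.lookup (xs≤max 0 columns)
    (∈-concatMap⁺ (support C) (Any.map (λ { refl → j∈ }) (∈-allFin i))))
  where columns = concatMap (support C) (allFin m)

theorem5p1 : (B : ℕ → FiniteMatrix) → EnumeratesFiniteIPR B →
    (D : Matrix ℕ ℕ) → IsDHMatrix B D →
    (m : ℕ) → .{{_ : NonZero m}} → (C : Matrix (Fin m) ℕ) →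
    ImagePartitionRegular (stack C D) →
    D ImageDominates (stack C D)
theorem5p1 B enum D isDH m C ipr x = y x , λ { (i , refl) → attained x i }
  where
  open DH B enum
  N : ℕ
  N = proj₁ (column-bound C)
  -- With `suc N` blocks, `H` is positive, so `head` has a column; every block being nonempty, these
  -- blocks cover all columns below `N`.
  open Domination D isDH C ipr (suc N) ℕ.z<s (λ i ≤j → proj₂ (column-bound C) i
    (ℕ.≤-trans (ℕ.n≤1+n N) (ℕ.≤-trans (n≤offset (suc N)) ≤j)))
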